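{- Let $(T,\cdot,e)$ be a monoid with a fixed generating set $G$, let $M$ be a $G$-uniform $T$-graded monad on $\mathbf{Set}$, and let $\mathcal{L}=(\Theta,\mathcal{O},\Lambda)$ be a trace logic for $M$ which is unit separating and inductively separating. Then the uniform-depth fragment of $\mathcal{L}$ is expressive with respect to trace equivalence: if states $x\in X$ and $y\in Y$ of graded $M$-coalgebras $(X,\gamma)$ and $(Y,\delta)$ satisfy $[\![\phi]\!]_\gamma(x)=[\![\phi]\!]_\delta(y)$ for every $k\in T$ and every formula $\phi\in\mathcal{F}_k(\mathcal{L})$ of uniform depth $k$, then $x$ and $y$ are trace equivalent.
   Context: A $T$-graded monad $M$ on $\mathbf{Set}$, for a monoid $(T,\cdot,e)$, consists of endofunctors $M_t$ ($t\in T$) and natural transformations $\mu^{s,t}\colon M_sM_t\to M_{s\cdot t}$, $\eta\colon\mathrm{Id}\to M_e$ such that $\mu^{r,s\cdot t}\circ M_r\mu^{s,t}=\mu^{r\cdot s,t}\circ\mu^{r,s}M_t$ and $\mu^{t,e}\circ M_t\eta=\mathrm{id}=\mu^{e,t}\circ\eta M_t$; in particular $(M_e,\mu^{e,e},\eta)$ is a monad and $(M_tX,\mu^{e,t}_X)$ is an $M_e$-algebra. A graded $M$-coalgebra is a set $X$ with maps $\gamma_t\colon X\to M_tX$ such that $\gamma_e=\eta_X$ and $\gamma_{s\cdot t}=\mu^{s,t}_X\circ M_s\gamma_t\circ\gamma_s$. States $x\in X$, $y\in Y$ of $(X,\gamma)$, $(Y,\delta)$ are trace equivalent if $M_t(!_X)(\gamma_t(x))=M_t(!_Y)(\delta_t(y))$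 for all $t\in T$, where $!_X\colon X\to1$ and $!_Y\colon Y\to1$. $M$ is $G$-uniform if for all $g\in G$, $t\in T$ the map $\mu^{g,t}\colon M_gM_t\to M_{g\cdot t}$ is (at each set $X$) a coequalizer of $M_g\mu^{e,t},\ \mu^{g,e}M_t\colon M_gM_eM_t\to M_gM_t$ in the Eilenberg-Moore category of $(M_e,\mu^{e,e},\eta)$. A graded coalgebraic modal logic $\mathcal{L}=(\Theta,\mathcal{O},\Lambda)$ consists of a set $\Theta$ of constants, a set $\mathcal{O}$ of propositional operators $p$ with finite arities $\mathrm{ar}(p)\in\mathbb{N}$, and a set $\Lambda$ of (unary) modal operators $\lambda$ with depths $\mathsf{d}(\lambda)\in G$. The semantics is given by a set $\Omega$, elements $\hat\theta\colon1\to\Omega$, maps $[\![p]\!]\colon\Omega^{\mathrm{ar}(p)}\to\Omega$ and maps $[\![\lambda]\!]\colon M_{\mathsf{d}(\lambda)}\Omega\to\Omega$. For a graded coalgebra $(X,\gamma)$, $[\![\phi]\!]_\gamma\colon X\to\Omega$ is defined by: $[\![\theta]\!]_\gamma$ is constant with value $\hat\theta$; $[\![p(\phi_1,\dots,\phi_n)]\!]_\gamma=[\![p]\!]\circ\langle[\![\phi_1]\!]_\gamma,\dots,[\![\phi_n]\!]_\gamma\rangle$; $[\![\lambda\phi]\!]_\gamma=[\![\lambda]\!]\circ M_{\mathsf{d}(\lambda)}[\![\phi]\!]_\gamma\circ\gamma_{\mathsf{d}(\lambda)}$. $\mathcal{L}$ is a trace logic if (i) $\Omega$ carries an $M_e$-algebra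 structure $o\colon M_e\Omega\to\Omega$; (ii) each $[\![p]\!]\colon(\Omega,o)^n\to(\Omega,o)$ is an $M_e$-algebra homomorphism; (iii) for each $\lambda\in\Lambda$ of depth $t$: $[\![\lambda]\!]\circ\mu^{t,e}_\Omega=[\![\lambda]\!]\circ M_to$ and $[\![\lambda]\!]\circ\mu^{e,t}_\Omega=o\circ M_e[\![\lambda]\!]$. The sets $\mathcal{F}_k(\mathcal{L})$ ($k\in T$) of formulae of uniform depth $k$ are defined inductively: $\theta\in\mathcal{F}_e(\mathcal{L})$ for $\theta\in\Theta$; $p(\phi_1,\dots,\phi_n)\in\mathcal{F}_k(\mathcal{L})$ if $p\in\mathcal{O}$, $n=\mathrm{ar}(p)$ and all $\phi_i\in\mathcal{F}_k(\mathcal{L})$; $\lambda\phi\in\mathcal{F}_k(\mathcal{L})$ if $\phi\in\mathcal{F}_l(\mathcal{L})$ with $\mathsf{d}(\lambda)\cdot l=k$. The uniform-depth fragment is $\bigcup_{k\in T}\mathcal{F}_k(\mathcal{L})$. For $\lambda\in\Lambda$ with $\mathsf{d}(\lambda)=g$ and an $M_e$-algebra homomorphism $h\colon(M_t1,\mu^{e,t})\to(\Omega,o)$, let $(\!|\lambda h|\!)\colon M_{g\cdot t}1\to\Omega$ be the unique $M_e$-algebra homomorphism with $(\!|\lambda h|\!)\circ\mu^{g,t}_1=[\![\lambda]\!]\circ M_gh$ (it exists by $G$-uniformity and (iii)). For $\theta\in\Theta$ put $(\!|\theta|\!)=o\circ M_e\hat\theta\colon M_e1\to\Omega$, and for $p\in\mathcal{O}$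 with $\mathrm{ar}(p)=0$ let $(\!|p|\!)\colon M_e1\to\Omega$ be the constant map with value $[\![p]\!]$. $\mathcal{L}$ is unit separating if the set $\{(\!|\theta|\!),(\!|p|\!)\colon M_e1\to\Omega\mid\theta\in\Theta,\ p\in\mathcal{O},\ \mathrm{ar}(p)=0\}$ is jointly injective. $\mathcal{L}$ is inductively separating if for all $g\in G$, $t\in T$ and every jointly injective set $\mathfrak{A}$ of $M_e$-algebra homomorphisms $(M_t1,\mu^{e,t})\to(\Omega,o)$ that is closed under $\mathcal{O}$ (i.e. $[\![p]\!]\circ\langle h_1,\dots,h_n\rangle\in\mathfrak{A}$ for $p\in\mathcal{O}$ of arity $n$ and $h_i\in\mathfrak{A}$), the set $\{(\!|\lambda h|\!)\colon M_{g\cdot t}1\to\Omega\mid\lambda\in\Lambda,\ \mathsf{d}(\lambda)=g,\ h\in\mathfrak{A}\}$ is jointly injective. -}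

module Defs where

open import Algebra.Core using (Op₂)
open import Algebra.Structures using (IsMonoid)
open import Axiom.UniquenessOfIdentityProofs.WithK using (uip)
open import Data.Fin.Base using (Fin)
open import Data.Nat.Base using (ℕ)
open import Data.Product.Base using (Σ; Σ-syntax; _×_; _,_; proj₁)
open import Data.Sum.Base using (_⊎_; [_,_])
open import Data.Unit.Polymorphic.Base using (⊤; tt)
open import Data.Vec.Base using (Vec; []; _∷_; lookup; map; tabulate)
open import Data.Vec.Properties using (lookup-map; lookup∘tabulate; tabulate-cong; tabulate∘lookup)
open import Data.Vec.Relation.Unary.All using (All)
open import Function.Base using (_∘_; id; const)
open import Level using (Level; suc)
open import Relation.Binary.Core using (Rel)
open import Relation.Binary.Definitions using (_Respects_)
open import Relation.Binary.PropositionalEquality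
  using (_≡_; _≗_; refl; sym; trans; cong; subst; module ≡-Reasoning)
open import Relation.Unary using (Pred; _∈_)

private
  variable
    ℓ : Level

module _ {T : Set ℓ} {_·_ : Op₂ T} {e : T} (isMonoid : IsMonoid {A = T} _≡_ _·_ e)
         (G : Pred T ℓ) where

  data Submonoid : Pred T ℓ where
    incl : ∀ {g} → g ∈ G → Submonoid g
    unit : Submonoid e
    mult : ∀ {s t} → Submonoid s → Submonoid t → Submonoid (s · t)

  Generates : Set ℓ
  Generates = ∀ t → t ∈ Submonoid

-- Graded monads on the category of types in Set ℓ, with equality of maps
-- taken pointwise.  Without function extensionality, functoriality has to
-- include preservation of this equality (fmap-cong).

record GradedMonad {T : Set ℓ} {_·_ : Op₂ T} {e : T}
                   (isMonoid : IsMonoid {A = T} _≡_ _·_ e) : Set (suc ℓ) where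
  open IsMonoid isMonoid public using (assoc; identityˡ; identityʳ)

  field
    M         : T → Set ℓ → Set ℓ
    fmap      : ∀ {t} {X Y : Set ℓ} → (X → Y) → M t X → M t Y
    fmap-cong : ∀ {t} {X Y : Set ℓ} {f g : X → Y} → f ≗ g → fmap {t} f ≗ fmap g
    fmap-id   : ∀ {t} {X : Set ℓ} → fmap {t} (id {A = X}) ≗ id
    fmap-∘    : ∀ {t} {X Y Z : Set ℓ} (f : Y → Z) (g : X → Y) →
                fmap {t} (f ∘ g) ≗ fmap f ∘ fmap g

    η         : ∀ {X : Set ℓ} → X → M e X
    η-natural : ∀ {X Y : Set ℓ} (f : X → Y) → η ∘ f ≗ fmap f ∘ η

    μ         : ∀ s t {X : Set ℓ} → M s (M t X) → M (s · t) X
    μ-natural : ∀ s t {X Y : Set ℓ} (f : X → Y) →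
                μ s t ∘ fmap (fmap f) ≗ fmap f ∘ μ s t

  -- Equal grades give equal, but not definitionally equal, functors.
  cast : ∀ {s t} {X : Set ℓ} → s ≡ t → M s X → M t X
  cast {X = X} eq = subst (λ t → M t X) eq

  field
    μ-assoc : ∀ r s t {X : Set ℓ} (m : M r (M s (M t X))) →
              μ r (s · t) (fmap (μ s t) m) ≡ cast (assoc r s t) (μ (r · s) t (μ r s m))
    μ-unitʳ : ∀ t {X : Set ℓ} (m : M t X) → cast (identityʳ t) (μ t e (fmap η m)) ≡ m
    μ-unitˡ : ∀ t {X : Set ℓ} (m : M t X) → cast (identityˡ t) (μ e t (η m)) ≡ m

  -- The components of μ into an equal grade; below, μᵉ⁻ t is μ^{e,t} : M_e M_t → M_t
  -- and μ⁻ᵉ t is μ^{t,e} : M_t M_e → M_t.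
  μ[_] : ∀ {s t u} → s · t ≡ u → {X : Set ℓ} → M s (M t X) → M u X
  μ[_] {s} {t} eq m = cast eq (μ s t m)

  μᵉ⁻ : ∀ t {X : Set ℓ} → M e (M t X) → M t X
  μᵉ⁻ t = μ[ identityˡ t ]

  μ⁻ᵉ : ∀ t {X : Set ℓ} → M t (M e X) → M t X
  μ⁻ᵉ t = μ[ identityʳ t ]

  μ[]-natural : ∀ {s t u} (p : s · t ≡ u) {X Y : Set ℓ} (f : X → Y) →
                μ[ p ] ∘ fmap (fmap f) ≗ fmap f ∘ μ[ p ]
  μ[]-natural refl f = μ-natural _ _ f

  μ[]-assoc : ∀ {r s t rs st u} (p : rs · t ≡ u) (q : r · s ≡ rs)
              (p′ : r · st ≡ u) (q′ : s · t ≡ st) {X : Set ℓ} (m : M r (M s (M t X))) →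
              μ[ p ] (μ[ q ] m) ≡ μ[ p′ ] (fmap μ[ q′ ] m)
  μ[]-assoc {r} {s} {t} p refl refl refl m =
    trans (cong (λ eq → cast eq (μ (r · s) t (μ r s m))) (uip p (assoc r s t)))
          (sym (μ-assoc r s t m))

module _ {T : Set ℓ} {_·_ : Op₂ T} {e : T} {isMonoid : IsMonoid {A = T} _≡_ _·_ e}
         (𝕄 : GradedMonad isMonoid) where
  open GradedMonad 𝕄

  record IsAlgebra (A : Set ℓ) (a : M e A → A) : Set ℓ where
    field
      act-η : a ∘ η ≗ id
      act-μ : a ∘ μᵉ⁻ e ≗ a ∘ fmap a

  record Algebra : Set (suc ℓ) where
    field
      Carrier   : Set ℓ
      act       : M e Carrier → Carrier
      isAlgebra : IsAlgebra Carrier act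
    open IsAlgebra isAlgebra public

open Algebra using (Carrier; act)

module _ {T : Set ℓ} {_·_ : Op₂ T} {e : T} {isMonoid : IsMonoid {A = T} _≡_ _·_ e}
         {𝕄 : GradedMonad isMonoid} where
  open GradedMonad 𝕄

  IsHom : (A B : Algebra 𝕄) → (Carrier A → Carrier B) → Set ℓ
  IsHom A B f = f ∘ act A ≗ act B ∘ fmap f

  record Hom (A B : Algebra 𝕄) : Set ℓ where
    constructor hom
    field
      ⌊_⌋   : Carrier A → Carrier B
      isHom : IsHom A B ⌊_⌋

  open Hom public using (⌊_⌋)

  _≗ₕ_ : {A B : Algebra 𝕄} → Rel (Hom A B) ℓ
  h ≗ₕ k = ⌊ h ⌋ ≗ ⌊ k ⌋

  record IsCoequalizer {A B C : Algebra 𝕄} (f g : Hom A B) (q : Hom B C) : Set (suc ℓ) where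
    field
      equality   : ⌊ q ⌋ ∘ ⌊ f ⌋ ≗ ⌊ q ⌋ ∘ ⌊ g ⌋
      coequalize : ∀ {D} (k : Hom B D) → ⌊ k ⌋ ∘ ⌊ f ⌋ ≗ ⌊ k ⌋ ∘ ⌊ g ⌋ → Hom C D
      universal  : ∀ {D} (k : Hom B D) (eq : ⌊ k ⌋ ∘ ⌊ f ⌋ ≗ ⌊ k ⌋ ∘ ⌊ g ⌋) →
                  ⌊ coequalize k eq ⌋ ∘ ⌊ q ⌋ ≗ ⌊ k ⌋
      unique     : ∀ {D} (k : Hom B D) (eq : ⌊ k ⌋ ∘ ⌊ f ⌋ ≗ ⌊ k ⌋ ∘ ⌊ g ⌋) (l : Hom C D) →
                  ⌊ l ⌋ ∘ ⌊ q ⌋ ≗ ⌊ k ⌋ → l ≗ₕ coequalize k eq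

  power : Algebra 𝕄 → ℕ → Algebra 𝕄
  power A n = record
    { Carrier   = Vec (Carrier A) n
    ; act       = act′
    ; isAlgebra = record { act-η = act′-η ; act-μ = act′-μ }
    }
    where
    open ≡-Reasoning
    π : Fin n → Vec (Carrier A) n → Carrier A
    π i v = lookup v i

    act′ : M e (Vec (Carrier A) n) → Vec (Carrier A) n
    act′ m = tabulate (λ i → act A (fmap (π i) m))

    act′-η : act′ ∘ η ≗ id
    act′-η v = trans
      (tabulate-cong λ i → trans (cong (act A) (sym (η-natural (π i) v))) (Algebra.act-η A (π i v)))
      (tabulate∘lookup v)

    act′-μ : act′ ∘ μᵉ⁻ e ≗ act′ ∘ fmap act′
    act′-μ m = tabulate-cong λ i → begin
      act A (fmap (π i) (μᵉ⁻ e m))            ≡⟨ cong (act A) (μ[]-natural (identityˡ e) (π i) m) ⟨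
      act A (μᵉ⁻ e (fmap (fmap (π i)) m))     ≡⟨ Algebra.act-μ A _ ⟩
      act A (fmap (act A) (fmap (fmap (π i)) m))
        ≡⟨ cong (act A) (fmap-∘ (act A) (fmap (π i)) m) ⟨
      act A (fmap (act A ∘ fmap (π i)) m)
        ≡⟨ cong (act A) (fmap-cong (λ v → lookup∘tabulate (λ j → act A (fmap (π j) v)) i) m) ⟨
      act A (fmap (π i ∘ act′) m)             ≡⟨ cong (act A) (fmap-∘ (π i) act′ m) ⟩
      act A (fmap (π i) (fmap act′ m))        ∎

  ⟨_⟩ : ∀ {A B : Algebra 𝕄} {n} → Vec (Hom A B) n → Hom A (power B n)
  ⟨_⟩ {A} {B} hs = hom tuple λ m → trans (sym (tabulate∘lookup (tuple (act A m)))) (tabulate-cong λ i → begin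
      lookup (tuple (act A m)) i                       ≡⟨ lookup-map i _ hs ⟩
      ⌊ lookup hs i ⌋ (act A m)                        ≡⟨ Hom.isHom (lookup hs i) m ⟩
      act B (fmap ⌊ lookup hs i ⌋ m)
        ≡⟨ cong (act B) (fmap-cong (λ a → lookup-map i (λ h → ⌊ h ⌋ a) hs) m) ⟨
      act B (fmap (λ a → lookup (tuple a) i) m)        ≡⟨ cong (act B) (fmap-∘ (λ v → lookup v i) tuple m) ⟩
      act B (fmap (λ v → lookup v i) (fmap tuple m))   ∎)
    where
    open ≡-Reasoning
    tuple : Carrier A → Vec (Carrier B) _
    tuple a = map (λ h → ⌊ h ⌋ a) hs

module _ {T : Set ℓ} {_·_ : Op₂ T} {e : T} {isMonoid : IsMonoid {A = T} _≡_ _·_ e}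
         (𝕄 : GradedMonad isMonoid) where
  open GradedMonad 𝕄

  algebra : T → Set ℓ → Algebra 𝕄
  algebra t X = record
    { Carrier   = M t X
    ; act       = μᵉ⁻ t
    ; isAlgebra = record
      { act-η = μ-unitˡ t
      ; act-μ = μ[]-assoc (identityˡ t) (identityˡ e) (identityˡ t) (identityˡ t)
      }
    }

  fmapμᵉ⁻-hom : ∀ s t X → Hom (algebra s (M e (M t X))) (algebra s (M t X))
  fmapμᵉ⁻-hom s t X = hom (fmap (μᵉ⁻ t)) λ m → sym (μ[]-natural (identityˡ s) (μᵉ⁻ t) m)

  μ⁻ᵉM-hom : ∀ s t X → Hom (algebra s (M e (M t X))) (algebra s (M t X))
  μ⁻ᵉM-hom s t X = hom (μ⁻ᵉ s) (μ[]-assoc (identityʳ s) (identityˡ s) (identityˡ s) (identityʳ s))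

  μ-hom : ∀ s t X → Hom (algebra s (M t X)) (algebra (s · t) X)
  μ-hom s t X = hom (μ s t) (μ[]-assoc refl (identityˡ s) (identityˡ (s · t)) refl)

  Uniform : Pred T ℓ → Set (suc ℓ)
  Uniform G = ∀ {g} → g ∈ G → ∀ t X →
    IsCoequalizer (fmapμᵉ⁻-hom g t X) (μ⁻ᵉM-hom g t X) (μ-hom g t X)

  record Coalgebra (X : Set ℓ) : Set ℓ where
    field
      γ   : ∀ t → X → M t X
      γ-e : γ e ≗ η
      γ-· : ∀ s t → γ (s · t) ≗ μ s t ∘ fmap (γ t) ∘ γ s

  𝟙 : Set ℓ
  𝟙 = ⊤

module _ {T : Set ℓ} {_·_ : Op₂ T} {e : T} {isMonoid : IsMonoid {A = T} _≡_ _·_ e}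
         {𝕄 : GradedMonad isMonoid} where
  open GradedMonad 𝕄
  open Coalgebra

  TraceEquivalent : {X Y : Set ℓ} → Coalgebra 𝕄 X → Coalgebra 𝕄 Y → X → Y → Set ℓ
  TraceEquivalent 𝕏 𝕐 x y =
    ∀ t → fmap {Y = 𝟙 𝕄} (const tt) (γ 𝕏 t x) ≡ fmap (const tt) (γ 𝕐 t y)

module _ {T : Set ℓ} {_·_ : Op₂ T} {e : T} {isMonoid : IsMonoid {A = T} _≡_ _·_ e}
         (𝕄 : GradedMonad isMonoid) (G : Pred T ℓ) where
  open GradedMonad 𝕄

  record Logic : Set (suc ℓ) where
    field
      Θ 𝒪 Λ   : Set ℓ
      ar      : 𝒪 → ℕ
      depth   : Λ → T
      depth∈G : ∀ l → depth l ∈ G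

      Ω       : Set ℓ
      ⟦_⟧ᶜ    : Θ → 𝟙 𝕄 → Ω
      ⟦_⟧ᵒ    : ∀ p → Vec Ω (ar p) → Ω
      ⟦_⟧ᵐ    : ∀ l → M (depth l) Ω → Ω

    data Formula : Set ℓ where
      con : Θ → Formula
      op  : ∀ p → Vec Formula (ar p) → Formula
      mod : Λ → Formula → Formula

    data UniformDepth : T → Formula → Set ℓ where
      con : ∀ θ → UniformDepth e (con θ)
      op  : ∀ {k} p {φs} → All (UniformDepth k) φs → UniformDepth k (op p φs)
      mod : ∀ {k l} m {φ} → UniformDepth l φ → depth m · l ≡ k → UniformDepth k (mod m φ)

    module _ {X : Set ℓ} (𝕏 : Coalgebra 𝕄 X) where
      open Coalgebra 𝕏

      ⟦_⟧  : Formula → X → Ω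
      ⟦_⟧* : ∀ {n} → Vec Formula n → X → Vec Ω n

      ⟦ con θ ⟧ x   = ⟦ θ ⟧ᶜ tt
      ⟦ op p φs ⟧ x = ⟦ p ⟧ᵒ (⟦ φs ⟧* x)
      ⟦ mod l φ ⟧ x = ⟦ l ⟧ᵐ (fmap ⟦ φ ⟧ (γ (depth l) x))

      ⟦ [] ⟧* x     = []
      ⟦ φ ∷ φs ⟧* x = ⟦ φ ⟧ x ∷ ⟦ φs ⟧* x

module _ {T : Set ℓ} {_·_ : Op₂ T} {e : T} {isMonoid : IsMonoid {A = T} _≡_ _·_ e}
         {𝕄 : GradedMonad isMonoid} {G : Pred T ℓ} where
  open GradedMonad 𝕄

  record TraceLogic (𝓛 : Logic 𝕄 G) : Set ℓ where
    open Logic 𝓛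
    field
      o          : M e Ω → Ω
      o-algebra  : IsAlgebra 𝕄 Ω o

    Ωₐ : Algebra 𝕄
    Ωₐ = record { Carrier = Ω ; act = o ; isAlgebra = o-algebra }

    field
      op-hom     : ∀ p → IsHom (power Ωₐ (ar p)) Ωₐ ⟦ p ⟧ᵒ
      mod-coeq   : ∀ l → ⟦ l ⟧ᵐ ∘ μ⁻ᵉ (depth l) ≗ ⟦ l ⟧ᵐ ∘ fmap o
      mod-hom    : ∀ l → ⟦ l ⟧ᵐ ∘ μᵉ⁻ (depth l) ≗ o ∘ fmap ⟦ l ⟧ᵐ

  -- Joint injectivity of the set { f i ∣ i : I } of maps A → B.
  JointlyInjective : {I A B : Set ℓ} → (I → A → B) → Set ℓ
  JointlyInjective f = ∀ a b → (∀ i → f i a ≡ f i b) → a ≡ b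

  module _ (uniform : Uniform 𝕄 G) {𝓛 : Logic 𝕄 G} (traceLogic : TraceLogic 𝓛) where
    open Logic 𝓛
    open TraceLogic traceLogic

    ⟪_⟫ᶜ : Θ → M e (𝟙 𝕄) → Ω
    ⟪ θ ⟫ᶜ = o ∘ fmap ⟦ θ ⟧ᶜ

    ⟪_⟫ᵒ : (Σ[ p ∈ 𝒪 ] ar p ≡ 0) → M e (𝟙 𝕄) → Ω
    ⟪ p , ar≡0 ⟫ᵒ = const (⟦ p ⟧ᵒ (subst (Vec Ω) (sym ar≡0) []))

    module _ {t : T} (l : Λ) (h : Hom (algebra 𝕄 t (𝟙 𝕄)) Ωₐ) where
      open ≡-Reasoning

      modHom : Hom (algebra 𝕄 (depth l) (M t (𝟙 𝕄))) Ωₐ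
      modHom = hom (⟦ l ⟧ᵐ ∘ fmap ⌊ h ⌋) λ m → begin
        ⟦ l ⟧ᵐ (fmap ⌊ h ⌋ (μᵉ⁻ (depth l) m))          ≡⟨ cong ⟦ l ⟧ᵐ (μ[]-natural (identityˡ (depth l)) ⌊ h ⌋ m) ⟨
        ⟦ l ⟧ᵐ (μᵉ⁻ (depth l) (fmap (fmap ⌊ h ⌋) m))   ≡⟨ mod-hom l _ ⟩
        o (fmap ⟦ l ⟧ᵐ (fmap (fmap ⌊ h ⌋) m))          ≡⟨ cong o (fmap-∘ ⟦ l ⟧ᵐ (fmap ⌊ h ⌋) m) ⟨
        o (fmap (⟦ l ⟧ᵐ ∘ fmap ⌊ h ⌋) m)               ∎

      modHom-coequalizes : ⌊ modHom ⌋ ∘ fmap (μᵉ⁻ t) ≗ ⌊ modHom ⌋ ∘ μ⁻ᵉ (depth l)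
      modHom-coequalizes m = begin
        ⟦ l ⟧ᵐ (fmap ⌊ h ⌋ (fmap (μᵉ⁻ t) m))           ≡⟨ cong ⟦ l ⟧ᵐ (fmap-∘ ⌊ h ⌋ (μᵉ⁻ t) m) ⟨
        ⟦ l ⟧ᵐ (fmap (⌊ h ⌋ ∘ μᵉ⁻ t) m)                ≡⟨ cong ⟦ l ⟧ᵐ (fmap-cong (Hom.isHom h) m) ⟩
        ⟦ l ⟧ᵐ (fmap (o ∘ fmap ⌊ h ⌋) m)               ≡⟨ cong ⟦ l ⟧ᵐ (fmap-∘ o (fmap ⌊ h ⌋) m) ⟩
        ⟦ l ⟧ᵐ (fmap o (fmap (fmap ⌊ h ⌋) m))          ≡⟨ mod-coeq l _ ⟨
        ⟦ l ⟧ᵐ (μ⁻ᵉ (depth l) (fmap (fmap ⌊ h ⌋) m))   ≡⟨ cong ⟦ l ⟧ᵐ (μ[]-natural (identityʳ (depth l)) ⌊ h ⌋ m) ⟩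
        ⟦ l ⟧ᵐ (fmap ⌊ h ⌋ (μ⁻ᵉ (depth l) m))          ∎

      ⟪_⟫ᵐ : Hom (algebra 𝕄 (depth l · t) (𝟙 𝕄)) Ωₐ
      ⟪_⟫ᵐ = IsCoequalizer.coequalize (uniform (depth∈G l) t (𝟙 𝕄)) modHom modHom-coequalizes

    UnitSeparating : Set ℓ
    UnitSeparating = JointlyInjective {I = Θ ⊎ (Σ[ p ∈ 𝒪 ] ar p ≡ 0)} [ ⟪_⟫ᶜ , ⟪_⟫ᵒ ]

    opHom : ∀ {A} p → Vec (Hom A Ωₐ) (ar p) → Hom A Ωₐ
    opHom {A} p hs = hom (⟦ p ⟧ᵒ ∘ ⌊ ⟨ hs ⟩ ⌋) λ m → begin
      ⟦ p ⟧ᵒ (⌊ ⟨ hs ⟩ ⌋ (act A m))                       ≡⟨ cong ⟦ p ⟧ᵒ (Hom.isHom ⟨ hs ⟩ m) ⟩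
      ⟦ p ⟧ᵒ (act (power Ωₐ (ar p)) (fmap ⌊ ⟨ hs ⟩ ⌋ m))  ≡⟨ op-hom p _ ⟩
      o (fmap ⟦ p ⟧ᵒ (fmap ⌊ ⟨ hs ⟩ ⌋ m))                 ≡⟨ cong o (fmap-∘ ⟦ p ⟧ᵒ ⌊ ⟨ hs ⟩ ⌋ m) ⟨
      o (fmap (⟦ p ⟧ᵒ ∘ ⌊ ⟨ hs ⟩ ⌋) m)                    ∎
      where open ≡-Reasoning

    ClosedUnder𝒪 : ∀ {A} → Pred (Hom A Ωₐ) ℓ → Set ℓ
    ClosedUnder𝒪 𝔄 = ∀ p {hs} → All 𝔄 hs → opHom p hs ∈ 𝔄

    -- Homomorphisms are compared pointwise, so a set of homomorphisms is a
    -- predicate that respects pointwise equality.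
    InductivelySeparating : Set (suc ℓ)
    InductivelySeparating =
      ∀ {g} → g ∈ G → ∀ t (𝔄 : Pred (Hom (algebra 𝕄 t (𝟙 𝕄)) Ωₐ) ℓ) → 𝔄 Respects _≗ₕ_ →
      JointlyInjective {I = Σ _ 𝔄} (λ (h , _) → ⌊ h ⌋) →
      ClosedUnder𝒪 𝔄 →
      JointlyInjective {I = Σ[ l ∈ Λ ] depth l ≡ g × Σ _ 𝔄}
        (λ (l , depth≡g , h , _) → subst (λ s → M (s · t) (𝟙 𝕄) → Ω) depth≡g ⌊ ⟪ l ⟫ᵐ h ⌋)

{-# OPTIONS --safe #-}
-- For each grade t, consider the homomorphisms h : M_t 1 → Ω for which some formula of
-- uniform depth t denotes the composite of h with the t-trace map X → M_t 1, in both
-- coalgebras at once.  This set is closed under 𝒪, so unit separation and inductive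
-- separation make it jointly injective, by induction on the generation of t from G.
-- States that agree on all these formulae therefore have equal traces.

module Submission where

open import Defs
open import Algebra.Core using (Op₂)
open import Algebra.Structures using (IsMonoid)
open import Data.Product.Base using (Σ; Σ-syntax; ∃-syntax; _×_; _,_)
open import Data.Sum.Base using (inj₁; inj₂)
open import Data.Unit.Polymorphic.Base using (tt)
open import Data.Vec.Base using (Vec; []; _∷_)
open import Data.Vec.Relation.Unary.All using (All; []; _∷_)
open import Data.Vec.Relation.Binary.Pointwise.Inductive using (Pointwise; []; _∷_)
open import Function.Base using (_∘_; const)
open import Level using (Level)
open import Relation.Binary.Definitions using (_Respects_)
open import Relation.Binary.PropositionalEquality
  using (_≡_; refl; sym; trans; cong; cong₂; subst; module ≡-Reasoning)
open import Relation.Unary using (Pred; _∈_)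

open ≡-Reasoning

module _ {ℓ} {T : Set ℓ} {_·_ : Op₂ T} {e : T} {isMonoid : IsMonoid {A = T} _≡_ _·_ e}
         {G : Pred T ℓ} where

  open IsMonoid isMonoid using (assoc; identityˡ; identityʳ)

  -- A proof that `t` is generated is a tree of products, whereas `step` only multiplies by one
  -- generator on the left. The gap is closed by left multiplication with a whole generated element,
  -- applied at the end to `e`.
  generator-induction : Generates isMonoid G → (P : Pred T ℓ) → P e →
                        (∀ {g} → g ∈ G → ∀ t → P t → P (g · t)) → ∀ t → P t
  generator-induction generates P base step t =
    subst P (identityʳ t) (prepend (generates t) e base)
    where
    -- Quantifying over every `t` with `P t` lets a product act as two successive prependings, up to
    -- associativity.
    prepend : ∀ {s} → Submonoid isMonoid G s → ∀ t → P t → P (s · t)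
    prepend (incl g∈G)           t pt = step g∈G t pt
    prepend unit                 t pt = subst P (sym (identityˡ t)) pt
    prepend (mult {r} {s} r∈ s∈) t pt =
      subst P (sym (assoc r s t)) (prepend r∈ (s · t) (prepend s∈ t pt))

module _ {ℓ} {T : Set ℓ} {_·_ : Op₂ T} {e : T} {isMonoid : IsMonoid {A = T} _≡_ _·_ e}
         {𝕄 : GradedMonad isMonoid} where
  open GradedMonad 𝕄
  open Algebra using (Carrier; act; act-η; act-μ)

  -- The universal extension of `f` along `η` from the free algebra on `X`. At `Ωₐ` and `⟦ θ ⟧ᶜ` its
  -- underlying map is `⟪ θ ⟫ᶜ` by definition.
  extend : ∀ {X} (A : Algebra 𝕄) → (X → Carrier A) → Hom (algebra 𝕄 e X) A
  extend A f = hom (act A ∘ fmap f) λ m → begin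
    act A (fmap f (μᵉ⁻ e m))             ≡⟨ cong (act A) (μ[]-natural (identityˡ e) f m) ⟨
    act A (μᵉ⁻ e (fmap (fmap f) m))      ≡⟨ act-μ A _ ⟩
    act A (fmap (act A) (fmap (fmap f) m)) ≡⟨ cong (act A) (fmap-∘ (act A) (fmap f) m) ⟨
    act A (fmap (act A ∘ fmap f) m)      ∎

  extend-η : ∀ {X} (A : Algebra 𝕄) (f : X → Carrier A) x → ⌊ extend A f ⌋ (η x) ≡ f x
  extend-η A f x = trans (cong (act A) (sym (η-natural f x))) (act-η A (f x))

  trace : ∀ {X} → Coalgebra 𝕄 X → ∀ t → X → M t (𝟙 𝕄)
  trace 𝕏 t x = fmap (const tt) (Coalgebra.γ 𝕏 t x)

  trace-e : ∀ {X} (𝕏 : Coalgebra 𝕄 X) x → trace 𝕏 e x ≡ η tt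
  trace-e 𝕏 x = trans (cong (fmap _) (Coalgebra.γ-e 𝕏 x)) (sym (η-natural (const tt) x))

  trace-· : ∀ {X} (𝕏 : Coalgebra 𝕄 X) s t x →
            trace 𝕏 (s · t) x ≡ μ s t (fmap (trace 𝕏 t) (Coalgebra.γ 𝕏 s x))
  trace-· 𝕏 s t x = begin
    fmap _ (γ (s · t) x)                     ≡⟨ cong (fmap _) (γ-· s t x) ⟩
    fmap _ (μ s t (fmap (γ t) (γ s x)))      ≡⟨ μ-natural s t _ _ ⟨
    μ s t (fmap (fmap _) (fmap (γ t) (γ s x))) ≡⟨ cong (μ s t) (fmap-∘ _ (γ t) _) ⟨
    μ s t (fmap (trace 𝕏 t) (γ s x))         ∎
    where open Coalgebra 𝕏

module _ {ℓ} {T : Set ℓ} {_·_ : Op₂ T} {e : T} {isMonoid : IsMonoid {A = T} _≡_ _·_ e}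
         {G : Pred T ℓ} {𝕄 : GradedMonad isMonoid} (uniform : Uniform 𝕄 G)
         {𝓛 : Logic 𝕄 G} (traceLogic : TraceLogic 𝓛) where
  open GradedMonad 𝕄
  open Logic 𝓛
  open TraceLogic traceLogic

  TraceHom : T → Set ℓ
  TraceHom t = Hom (algebra 𝕄 t (𝟙 𝕄)) Ωₐ

  module _ {X : Set ℓ} (𝕏 : Coalgebra 𝕄 X) where
    open Coalgebra 𝕏 using (γ)

    -- The denotation of `φ` factors through the trace map, with `h` as second factor.
    Realizes : ∀ {t} → Formula → TraceHom t → Set ℓ
    Realizes {t} φ h = ∀ x → ⟦_⟧ 𝕏 φ x ≡ ⌊ h ⌋ (trace 𝕏 t x)

    realizes-con : ∀ θ → Realizes (con θ) (extend Ωₐ ⟦ θ ⟧ᶜ)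
    realizes-con θ x = sym (trans (cong ⌊ extend Ωₐ ⟦ θ ⟧ᶜ ⌋ (trace-e 𝕏 x)) (extend-η Ωₐ ⟦ θ ⟧ᶜ tt))

    realizes-tuple : ∀ {t n} {φs : Vec Formula n} {hs : Vec (TraceHom t) n} →
                     Pointwise Realizes φs hs →
                     ∀ x → ⟦_⟧* 𝕏 φs x ≡ ⌊ ⟨_⟩ {B = Ωₐ} hs ⌋ (trace 𝕏 t x)
    realizes-tuple []       x = refl
    realizes-tuple (r ∷ rs) x = cong₂ _∷_ (r x) (realizes-tuple rs x)

    realizes-op : ∀ {t} p {φs} {hs : Vec (TraceHom t) (ar p)} → Pointwise Realizes φs hs →
                  Realizes (op p φs) (opHom uniform traceLogic p hs)
    realizes-op p rs x = cong ⟦ p ⟧ᵒ (realizes-tuple rs x)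

    -- A trace of grade `depth l · t` is a value of `μ`, and on such values the coequalizer computes
    -- `⟪ l ⟫ᵐ h` as `⟦ l ⟧ᵐ` after `fmap ⌊ h ⌋`.
    realizes-mod : ∀ {t} l {φ} {h : TraceHom t} → Realizes φ h →
                   Realizes (mod l φ) (⟪_⟫ᵐ uniform traceLogic l h)
    realizes-mod {t} l {φ} {h} r x = begin
      ⟦ l ⟧ᵐ (fmap (⟦_⟧ 𝕏 φ) (γ g x))                ≡⟨ cong ⟦ l ⟧ᵐ (fmap-cong r _) ⟩
      ⟦ l ⟧ᵐ (fmap (⌊ h ⌋ ∘ trace 𝕏 t) (γ g x))      ≡⟨ cong ⟦ l ⟧ᵐ (fmap-∘ ⌊ h ⌋ (trace 𝕏 t) _) ⟩
      ⟦ l ⟧ᵐ (fmap ⌊ h ⌋ (fmap (trace 𝕏 t) (γ g x))) ≡⟨ universal (modHom uniform traceLogic l h) _ _ ⟨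
      ⌊ h′ ⌋ (μ g t (fmap (trace 𝕏 t) (γ g x)))      ≡⟨ cong ⌊ h′ ⌋ (trace-· 𝕏 g t x) ⟨
      ⌊ h′ ⌋ (trace 𝕏 (g · t) x)                     ∎
      where
      g  = depth l
      h′ = ⟪_⟫ᵐ uniform traceLogic l h
      open IsCoequalizer (uniform (depth∈G l) t (𝟙 𝕄)) using (universal)

  module _ {X Y : Set ℓ} (𝕏 : Coalgebra 𝕄 X) (𝕐 : Coalgebra 𝕄 Y) where

    -- One formula has to serve both coalgebras, because `x` and `y` are compared formula by
    -- formula.
    Definable : ∀ {t} → Pred (TraceHom t) ℓ
    Definable {t} h = ∃[ φ ] UniformDepth t φ × Realizes 𝕏 φ h × Realizes 𝕐 φ h

    DefinablesSeparate : Pred T ℓ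
    DefinablesSeparate t =
      JointlyInjective {𝕄 = 𝕄} {G = G} {I = Σ (TraceHom t) Definable} (λ (h , _) → ⌊ h ⌋)

    definable-respects-≗ : ∀ {t} → Definable {t} Respects _≗ₕ_
    definable-respects-≗ h≗k (φ , u , r , r′) =
      φ , u , (λ x → trans (r x) (h≗k _)) , (λ y → trans (r′ y) (h≗k _))

    definable-con : ∀ θ → extend Ωₐ ⟦ θ ⟧ᶜ ∈ Definable
    definable-con θ = con θ , con θ , realizes-con 𝕏 θ , realizes-con 𝕐 θ

    definables : ∀ {t n} {hs : Vec (TraceHom t) n} → All (Definable {t}) hs →
                 Σ[ φs ∈ Vec Formula n ] All (UniformDepth t) φs × Pointwise (Realizes 𝕏) φs hs ×
                   Pointwise (Realizes 𝕐) φs hs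
    definables []                      = [] , [] , [] , []
    definables ((φ , u , r , r′) ∷ ds) =
      let φs , us , rs , rs′ = definables ds in φ ∷ φs , u ∷ us , r ∷ rs , r′ ∷ rs′

    definable-op : ∀ {t} → ClosedUnder𝒪 uniform traceLogic (Definable {t})
    definable-op p ds =
      let φs , us , rs , rs′ = definables ds
      in op p φs , op p us , realizes-op 𝕏 p rs , realizes-op 𝕐 p rs′

    definable-mod : ∀ {t} l {h : TraceHom t} → h ∈ Definable → ⟪_⟫ᵐ uniform traceLogic l h ∈ Definable
    definable-mod l {h} (φ , u , r , r′) =
      mod l φ , mod l u refl , realizes-mod 𝕏 l {φ} {h} r , realizes-mod 𝕐 l {φ} {h} r′

    separate-e : UnitSeparating uniform traceLogic → DefinablesSeparate e
    separate-e unitSeparating a b agree = unitSeparating a b λ where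
      (inj₁ θ) → agree (extend Ωₐ ⟦ θ ⟧ᶜ , definable-con θ)
      -- A nullary operator yields a constant map, so its values at `a` and `b` coincide.
      (inj₂ p) → refl

    separate-· : InductivelySeparating uniform traceLogic →
                 ∀ {g} → g ∈ G → ∀ t → DefinablesSeparate t → DefinablesSeparate (g · t)
    separate-· inductivelySeparating g∈G t separate a b agree =
      inductivelySeparating g∈G t Definable (λ {h} {k} → definable-respects-≗ {x = h} {k})
        separate definable-op a b λ where
          -- Matching on `refl` identifies `g` with `depth l`, which removes the transport; the map
          -- compared is then itself definable.
          (l , refl , h , d) → agree (⟪_⟫ᵐ uniform traceLogic l h , definable-mod l {h} d)

theorem5p15 : ∀ {ℓ : Level} {T : Set ℓ} {_·_ : Op₂ T} {e : T}
    (isMonoid : IsMonoid {A = T} _≡_ _·_ e)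
    (G : Pred T ℓ) (generates : Generates isMonoid G)
    (𝕄 : GradedMonad isMonoid) (uniform : Uniform 𝕄 G)
    (𝓛 : Logic 𝕄 G) (traceLogic : TraceLogic 𝓛) →
    UnitSeparating uniform traceLogic →
    InductivelySeparating uniform traceLogic →
    ∀ {X Y : Set ℓ} (𝕏 : Coalgebra 𝕄 X) (𝕐 : Coalgebra 𝕄 Y) (x : X) (y : Y) →
    (∀ k φ → Logic.UniformDepth 𝓛 k φ → Logic.⟦_⟧ 𝓛 𝕏 φ x ≡ Logic.⟦_⟧ 𝓛 𝕐 φ y) →
    TraceEquivalent 𝕏 𝕐 x y
theorem5p15 isMonoid G generates 𝕄 uniform 𝓛 traceLogic unitSep indSep 𝕏 𝕐 x y equal t =
  generator-induction generates (DefinablesSeparate uniform traceLogic 𝕏 𝕐)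
    (separate-e uniform traceLogic 𝕏 𝕐 unitSep)
    (separate-· uniform traceLogic 𝕏 𝕐 indSep)
    t (trace 𝕏 t x) (trace 𝕐 t y)
    -- The values of `h` at the two traces are those of `φ` at `x` and `y`, equal by assumption
    -- since `φ` has uniform depth `t`.
    λ (h , φ , u , r , r′) → trans (sym (r x)) (trans (equal t φ u) (r′ y))
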